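{- Let $n\ge 2$. To each line of play of Planted Brussels Sprouts of order $n$ associate a sequence $(a_1,\dots,a_{n-1})$ as follows. Suppose the $k$-th move joins free arms with short labels $i$ and $j$ lying in a common region. In that region, just before the move, let $i^-$ and $j^-$ be the short labels of the free arms immediately counterclockwise from the arm $i$ and from the arm $j$, respectively. Set $a_k=\min(i^-,j^-)$. Then distinct lines of play give distinct sequences. Moreover, the set of sequences obtained is exactly the set of parking functions of length $n-1$.
   Context: Planted Brussels Sprouts of order $n$: start with a closed disk with $n$ marked points on its boundary circle, labeled $1,\dots,n$ in clockwise order. Attached to each marked point is an arm, a short segment pointing into the interior of the disk; these arms are free. A move consists of two steps. First, choose two free arms and join their free ends by a simple curve (an arc) in the disk that does not intersect any previously drawn arc or arm; the two joined arms cease to be free. Second, mark a point (a notch) on the arc, from which two new free arms emanate, one on each side of the arc. The game ends when no move is possible. A line of play is the full sequence of moves. Two lines of play are the same iff for each $k$ the arms joined at the $k$-th move coincide. Arms are identified by long labels: the original arm $i$ has long label $i$, and when arms with long labels $\alpha,\beta$ are joined, the new arms have long labels $(\alpha,\beta)$ and $(\beta,\alpha)$. Short labels: the original arm at point $i$ has short label $i$. If an arc joins arms with short labels $i$ and $j$, the two new arms receive short labels $i$ and $j$, placed so that, going clockwise around the notch, one sees the old arm $i$, the new arm $i$, the old arm $j$, and the new arm $j$. Regions and subgames: at any stage, the drawn arcs divide the disk into regions. The free arms in a region form a subgame, and any move joins two free arms of the same region. Within a region, the free arms carry distinct short labels and have a cyclic (clockwise) order around the region. "Immediately counterclockwise"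 refers to the preceding free arm in this cyclic order. A parking function of length $n-1$ is a sequence $(a_1,\dots,a_{n-1})$ of integers in $\{1,\dots,n-1\}$ such that, if it is rearranged in weakly increasing order $a'_1\le\cdots\le a'_{n-1}$, then $a'_i\le i$ for all $i$. -}

module Defs where

open import Data.Fin using (Fin; toℕ)
open import Data.List using (List; []; _∷_; _++_; [_]; length; lookup; map; allFin)
open import Data.List.NonEmpty using (last) renaming (_∷_ to _∷⁺_)
open import Data.List.Relation.Binary.Pointwise using (Pointwise)
open import Data.List.Relation.Unary.All using (All)
open import Data.List.Sort using (sort)
open import Data.Nat using (ℕ; suc; _≤_; _⊓_)
open import Data.Nat.Properties using (≤-decTotalOrder)
open import Data.Product using (_×_; _,_)
open import Data.Sum using (_⊎_)
open import Relation.Binary.PropositionalEquality using (_≡_)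
open import Relation.Nullary using (¬_)

-- Arms are identified with their long labels.  The marked points 1,…,n are
-- represented by Fin n, so the point i : Fin n carries the label suc (toℕ i).
data Arm (n : ℕ) : Set where
  original : Fin n → Arm n
  ⟨_,_⟩    : Arm n → Arm n → Arm n

-- Of the two arms created by joining α and β, ⟨ α , β ⟩ is the one that comes
-- right after α clockwise around the notch; it inherits the short label of α.
shortLabel : ∀ {n} → Arm n → ℕ
shortLabel (original i) = suc (toℕ i)
shortLabel ⟨ α , β ⟩    = shortLabel α

-- The free arms of a region in clockwise order.  The order is cyclic: the
-- first arm of the list comes after the last one.
Region : ℕ → Set
Region n = List (Arm n)

Position : ℕ → Set
Position n = List (Region n)

start : ∀ n → Position n
start n = [ map original (allFin n) ]

-- The arm immediately counterclockwise from α in the region whose arms, read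
-- clockwise beginning at α, are α ∷ rest.  It is α itself if rest is empty.
ccwFrom : ∀ {n} → Arm n → List (Arm n) → Arm n
ccwFrom α rest = last (α ∷⁺ rest)

-- A choice of two free arms α and β in a common region.  The pair is
-- unordered; α denotes the one listed first.
record Move {n} (s : Position n) : Set where
  field
    regionsˡ regionsʳ    : List (Region n)
    α β                  : Arm n
    before between after : List (Arm n)
    s≡ : s ≡ regionsˡ ++ (before ++ α ∷ between ++ β ∷ after) ∷ regionsʳ

  joinedArms : Arm n × Arm n
  joinedArms = α , β

  -- The arc from α to β separates the arms clockwise from α to β from those
  -- clockwise from β to α.  Clockwise around the notch one sees α, ⟨ α , β ⟩,
  -- β, ⟨ β , α ⟩, so ⟨ α , β ⟩ lies on the side of `between`, and in the
  -- cyclic order of that side it stands between the places of β and α.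
  result : Position n
  result = regionsˡ ++ (⟨ α , β ⟩ ∷ between) ∷ (before ++ ⟨ β , α ⟩ ∷ after) ∷ regionsʳ

  α⁻ β⁻ : Arm n
  α⁻ = ccwFrom α (between ++ β ∷ after ++ before)
  β⁻ = ccwFrom β (after ++ before ++ α ∷ between)

  value : ℕ
  value = shortLabel α⁻ ⊓ shortLabel β⁻

open Move using (joinedArms; result; value)

data Play {n} (s : Position n) : Set where
  end : ¬ Move s → Play s
  _▸_ : (m : Move s) → Play (result m) → Play s

LineOfPlay : ℕ → Set
LineOfPlay n = Play (start n)

joins : ∀ {n} {s : Position n} → Play s → List (Arm n × Arm n)
joins (end _) = []
joins (m ▸ p) = joinedArms m ∷ joins p

sequence : ∀ {n} {s : Position n} → Play s → List ℕ
sequence (end _) = []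
sequence (m ▸ p) = value m ∷ sequence p

SamePair : ∀ {n} → Arm n × Arm n → Arm n × Arm n → Set
SamePair (α , β) (γ , δ) = (α ≡ γ × β ≡ δ) ⊎ (α ≡ δ × β ≡ γ)

_≈_ : ∀ {n} {s : Position n} → Play s → Play s → Set
p ≈ q = Pointwise SamePair (joins p) (joins q)

record IsParkingFunction (m : ℕ) (as : List ℕ) : Set where
  field
    hasLength : length as ≡ m
    inRange   : All (λ a → 1 ≤ a × a ≤ m) as
    -- indices in Fin start from 0, hence the suc
    sorted≤   : let as′ = sort ≤-decTotalOrder as in
                ∀ i → lookup as′ i ≤ suc (toℕ i)

{-# OPTIONS --safe #-}
module Submission where

{-
Every region lists its arms by increasing short label, and no short label
occurs in two regions.  Up to labels, a move therefore cuts some region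
P ++ S ++ Q, with P and S nonempty, into S and P ++ Q, and its value is the
last label of P.  For a sequence as and a region with labels x₁, x₂, …, take
the walk that starts at 1 and whose i-th step is (multiplicity of xᵢ in as) − 1.
The sequences of the plays from a position are those with entries among the
labels of the position for which each of these walks first reaches 0 at its
end; for the starting position these are the parking functions.  Given such a
sequence a ∷ as, the first move is forced: its region is the one containing a,
P ends at a, and S is the stretch after a over which the walk for as descends
by one for the first time.
-}

open import Algebra.Properties.CommutativeSemigroup using (xy∙z≈xz∙y)
open import Data.Empty using (⊥-elim)
open import Data.Fin using (Fin; zero; suc; toℕ; fromℕ<)
open import Data.Fin.Properties using (toℕ<n; toℕ-fromℕ<)
open import Data.List
  using (List; []; _∷_; _++_; _∷ʳ_; [_]; length; lookup; map; filter; allFin; tabulate; initLast; _∷ʳ′_)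
open import Data.List.Membership.Propositional using (_∈_; _∉_; find)
open import Data.List.Membership.Propositional.Properties
  using (∈-++⁻; ∈-++⁺ˡ; ∈-++⁺ʳ; ∈-map⁻; ∈-map⁺; ∈-∃++; ∈-tabulate⁺; ∈-tabulate⁻)
open import Data.List.NonEmpty using (List⁺; toList; last) renaming (_∷_ to _∷⁺_)
open import Data.List.Properties
  using (map-++; map-tabulate; ∷ʳ-injectiveʳ; ∷ʳ-++; ++-assoc; ++-identityʳ; ∷-injective;
         filter-accept; filter-reject; filter-none)
open import Data.List.Relation.Binary.Disjoint.Propositional using (Disjoint)
open import Data.List.Relation.Binary.Permutation.Propositional
  using (_↭_; ↭-sym; ↭-trans; ↭-reflexive; ↭⇒↭ₛ)
open import Data.List.Relation.Binary.Permutation.Propositional.Properties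
  using (filter-↭; ↭-length; ∈-resp-↭; map⁺; shifts; All-resp-↭)
open import Data.List.Relation.Binary.Pointwise using ([]; _∷_)
open import Data.List.Relation.Binary.Sublist.Propositional
  using (_⊆_; []; _∷_; ⊆-refl) renaming (_∷ʳ_ to skip; lookup to ⊆-lookup)
import Data.List.Relation.Binary.Sublist.Propositional.Properties as Sublist
open import Data.List.Relation.Unary.All as All using (All; []; _∷_)
import Data.List.Relation.Unary.All.Properties as All
open import Data.List.Relation.Unary.AllPairs as AllPairs using (AllPairs; []; _∷_)
import Data.List.Relation.Unary.AllPairs.Properties as AllPairs
open import Data.List.Relation.Unary.Any as Any using (Any; here; there)
open import Data.List.Relation.Unary.Any.Properties using (lookup-index)
import Data.List.Relation.Unary.Any.Properties as Any
open import Data.List.Relation.Unary.Sorted.TotalOrder.Properties using (Sorted⇒AllPairs)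
open import Data.List.Sort using (sort; sort-↭; sort-↗)
open import Data.Nat using (ℕ; zero; suc; _+_; _∸_; _⊓_; _≤_; _<_; z≤n; s≤s; s≤s⁻¹; _≟_)
open import Data.Nat.Properties
open import Data.Product using (∃; ∃₂; _×_; _,_; proj₁; proj₂)
open import Data.Sum using (_⊎_; inj₁; inj₂)
open import Function using (_∘_; _on_)
open import Function.Bundles using (_⇔_; mk⇔; Equivalence)
open import Function.Definitions using (Congruent; Injective)
open import Level using (Level)
open import Relation.Binary.Core using (Rel)
open import Relation.Binary.PropositionalEquality
  using (_≡_; _≢_; refl; sym; trans; cong; cong₂; subst; subst₂)
import Relation.Binary.PropositionalEquality as ≡
open import Relation.Nullary using (¬_; contradiction)
open import Relation.Unary using (Pred)
open import Data.List.Relation.Binary.Permutation.Setoid.Properties (≡.setoid ℕ) using (Unique-resp-↭)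
open import Defs

private variable
  ℓ : Level
  A B : Set
  R : Rel A ℓ
  h k : ℕ
  c d : ℕ → ℕ

-- Lists

AllPairs-resp-⊇ : ∀ {xs ys : List A} → xs ⊆ ys → AllPairs R ys → AllPairs R xs
AllPairs-resp-⊇ []         []       = []
AllPairs-resp-⊇ (skip y τ) (_ ∷ ps) = AllPairs-resp-⊇ τ ps
AllPairs-resp-⊇ (refl ∷ τ) (p ∷ ps) = All.anti-mono (⊆-lookup τ) p ∷ AllPairs-resp-⊇ τ ps

AllPairs-++⁻ : ∀ (xs : List A) {ys x y} → AllPairs R (xs ++ ys) → x ∈ xs → y ∈ ys → R x y
AllPairs-++⁻ (x ∷ xs) (p ∷ _)  (here refl) y∈ = All.lookup p (∈-++⁺ʳ xs y∈)
AllPairs-++⁻ (x ∷ xs) (_ ∷ ps) (there x∈)  y∈ = AllPairs-++⁻ xs ps x∈ y∈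

AllPairs-middle : ∀ (xs : List A) {x ys} → AllPairs R (xs ++ x ∷ ys) → All (λ y → R y x) xs × All (R x) ys
AllPairs-middle []       (p ∷ _)  = [] , p
AllPairs-middle (x ∷ xs) (p ∷ ps) with q , r ← AllPairs-middle xs ps =
  All.lookup p (∈-++⁺ʳ xs (here refl)) ∷ q , r

-- A move replaces one region of a position by two; this lemma and the next two carry properties of
-- positions across that replacement.
AllPairs-replace : ∀ (xs : List A) {x y z ys} → (∀ {w} → R w x → R w y × R w z) →
  (∀ {w} → R x w → R y w × R z w) → R y z → AllPairs R (xs ++ x ∷ ys) → AllPairs R (xs ++ y ∷ z ∷ ys)
AllPairs-replace [] _ right yz (p ∷ ps) =
  (yz ∷ All.map (proj₁ ∘ right) p) ∷ All.map (proj₂ ∘ right) p ∷ ps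
AllPairs-replace (w ∷ xs) left right yz (p ∷ ps) with q , r ∷ s ← All.++⁻ xs p =
  All.++⁺ q (proj₁ (left r) ∷ proj₂ (left r) ∷ s) ∷ AllPairs-replace xs left right yz ps

All-replace : ∀ {P : Pred A ℓ} (xs : List A) {x y z ys} → (P x → P y × P z) →
  All P (xs ++ x ∷ ys) → All P (xs ++ y ∷ z ∷ ys)
All-replace xs f ps with qs , p ∷ rs ← All.++⁻ xs ps = All.++⁺ qs (proj₁ (f p) ∷ proj₂ (f p) ∷ rs)

Any-replace : ∀ {P : Pred A ℓ} (xs : List A) {x y z ys} → (P x ⇔ (P y ⊎ P z)) →
  Any P (xs ++ x ∷ ys) ⇔ Any P (xs ++ y ∷ z ∷ ys)
Any-replace {P = P} [] {x} {y} {z} {ys} e = mk⇔ to from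
  where
  to : Any P (x ∷ ys) → Any P (y ∷ z ∷ ys)
  to (here p) with Equivalence.to e p
  ... | inj₁ q = here q
  ... | inj₂ q = there (here q)
  to (there p) = there (there p)
  from : Any P (y ∷ z ∷ ys) → Any P (x ∷ ys)
  from (here p)          = here (Equivalence.from e (inj₁ p))
  from (there (here p))  = here (Equivalence.from e (inj₂ p))
  from (there (there p)) = there p
Any-replace (w ∷ xs) e = mk⇔
  (λ { (here p) → here p ; (there p) → there (Equivalence.to (Any-replace xs e) p) })
  (λ { (here p) → here p ; (there p) → there (Equivalence.from (Any-replace xs e) p) })

-- At two different places, `x` and `x′` would be related by `R` one way or the other. This serves
-- for arms ordered by label within a region and for pairwise disjoint regions.
middle-unique : ∀ (xs xs′ : List A) {x x′ ys ys′} → AllPairs R (xs ++ x ∷ ys) →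
  xs ++ x ∷ ys ≡ xs′ ++ x′ ∷ ys′ → ¬ R x x′ → ¬ R x′ x → xs ≡ xs′ × x ≡ x′ × ys ≡ ys′
middle-unique []       []         _        refl _  _  = refl , refl , refl
middle-unique []       (x ∷ xs′)  (p ∷ _)  refl ¬r _  = ⊥-elim (¬r (All.lookup p (∈-++⁺ʳ xs′ (here refl))))
middle-unique (x ∷ xs) []         (p ∷ _)  refl _  ¬r = ⊥-elim (¬r (All.lookup p (∈-++⁺ʳ xs (here refl))))
middle-unique (x ∷ xs) (x′ ∷ xs′) (_ ∷ ps) eq ¬r ¬r′ with refl , eq′ ← ∷-injective eq
  with refl , refl , refl ← middle-unique xs xs′ ps eq′ ¬r ¬r′ = refl , refl , refl

last-∷ʳ : ∀ (xs : List A) {x y ys} → y ∷ ys ≡ xs ∷ʳ x → last (y ∷⁺ ys) ≡ x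
last-∷ʳ xs {ys = ys} eq with initLast ys
... | []        = ∷ʳ-injectiveʳ [] xs eq
... | zs ∷ʳ′ z  = ∷ʳ-injectiveʳ (_ ∷ zs) xs eq

init-last : ∀ (xs : List⁺ A) → ∃ λ ys → toList xs ≡ ys ∷ʳ last xs
init-last (x ∷⁺ xs) with initLast xs
... | []       = [] , refl
... | ys ∷ʳ′ y = x ∷ ys , refl

last-++ : ∀ (x : A) xs y ys → last (x ∷⁺ xs ++ y ∷ ys) ≡ last (y ∷⁺ ys)
last-++ x xs y ys with zs , eq ← init-last (y ∷⁺ ys) =
  last-∷ʳ (x ∷ xs ++ zs) (cong (x ∷_) (trans (cong (xs ++_) eq) (sym (++-assoc xs zs _))))

last-∈ : ∀ (xs : List⁺ A) → last xs ∈ toList xs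
last-∈ xs with ys , eq ← init-last xs = subst (last xs ∈_) (sym eq) (∈-++⁺ʳ ys (here refl))

snoc⁺ : ∀ (xs : List A) x → ∃ λ (ys : List⁺ A) → toList ys ≡ xs ∷ʳ x × last ys ≡ x
snoc⁺ []       x = x ∷⁺ [] , refl , refl
snoc⁺ (y ∷ xs) x = y ∷⁺ (xs ∷ʳ x) , refl , last-∷ʳ (y ∷ xs) refl

toList-injective : ∀ {xs ys : List⁺ A} → toList xs ≡ toList ys → xs ≡ ys
toList-injective {xs = _ ∷⁺ _} {_ ∷⁺ _} refl = refl

++-∷-≢[] : ∀ (xs : List A) {x ys} → xs ++ x ∷ ys ≢ []
++-∷-≢[] (_ ∷ _) ()

map-middle : ∀ (f : A → B) xs {x y ys} → f x ≡ f y → map f (xs ++ x ∷ ys) ≡ map f (xs ++ y ∷ ys)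
map-middle f []       eq = cong₂ _∷_ eq refl
map-middle f (x ∷ xs) eq = cong (f x ∷_) (map-middle f xs eq)

-- Occurrences

occ : List ℕ → ℕ → ℕ
occ as x = length (filter (x ≟_) as)

occ-≡ : ∀ {a x} as → x ≡ a → occ (a ∷ as) x ≡ suc (occ as x)
occ-≡ {x = x} as eq = cong length (filter-accept (x ≟_) eq)

occ-≢ : ∀ {a x} as → x ≢ a → occ (a ∷ as) x ≡ occ as x
occ-≢ {x = x} as neq = cong length (filter-reject (x ≟_) neq)

occ-none : ∀ {x} as → All (x ≢_) as → occ as x ≡ 0
occ-none {x} as neq = cong length (filter-none (x ≟_) neq)

occ-↭ : ∀ {as bs} x → as ↭ bs → occ as x ≡ occ bs x
occ-↭ x as↭bs = ↭-length (filter-↭ (x ≟_) as↭bs)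

-- First passage walks

-- The walk that starts at height h and steps by c x ∸ 1 for each x in turn
-- reaches height 0, and does so for the first time at the end of the list.
data FirstPassage (c : ℕ → ℕ) : ℕ → List ℕ → Set where
  done : FirstPassage c 0 []
  step : ∀ {h x xs} → FirstPassage c (h + c x) xs → FirstPassage c (suc h) (x ∷ xs)

FirstPassage-height : ∀ {xs} → h ≡ k → FirstPassage c h xs → FirstPassage c k xs
FirstPassage-height refl p = p

FirstPassage-resp : ∀ {xs} → (∀ {x} → x ∈ xs → c x ≡ d x) → FirstPassage c h xs → FirstPassage d h xs
FirstPassage-resp c≗d done = done
FirstPassage-resp {d = d} c≗d (step {h} p) =
  step (FirstPassage-height (cong (h +_) (c≗d (here refl))) (FirstPassage-resp (c≗d ∘ there) p))

FirstPassage-++ : ∀ {xs ys} → FirstPassage c h xs → FirstPassage c k ys → FirstPassage c (h + k) (xs ++ ys)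
FirstPassage-++ done q = q
FirstPassage-++ {c = c} {k = k} (step {h} {x} p) q =
  step (FirstPassage-height (xy∙z≈xz∙y +-commutativeSemigroup h (c x) k) (FirstPassage-++ p q))

-- The walk descends by at most one per step, so it meets height `k` on its way down; `ys` ends at
-- the first visit. Splitting `xs` rather than its image divides the arms themselves.
FirstPassage-split : ∀ (f : A → ℕ) h xs → FirstPassage c (h + k) (map f xs) →
  ∃₂ λ ys zs → xs ≡ ys ++ zs × FirstPassage c h (map f ys) × FirstPassage c k (map f zs)
FirstPassage-split f zero xs p = [] , xs , refl , done , p
FirstPassage-split {c = c} {k} f (suc h) (x ∷ xs) (step p)
  with ys , zs , refl , q , r ← FirstPassage-split f (h + c (f x)) xs
         (FirstPassage-height (xy∙z≈xz∙y +-commutativeSemigroup h k (c (f x))) p)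
  = x ∷ ys , zs , refl , step q , r

-- Both walks start at the same height and read prefixes of the same list, and each prefix ends at
-- the first arrival at 0.
FirstPassage-prefix-unique : ∀ (f : A → ℕ) xs xs′ {ys ys′} →
  FirstPassage c h (map f xs) → FirstPassage c h (map f xs′) →
  xs ++ ys ≡ xs′ ++ ys′ → xs ≡ xs′ × ys ≡ ys′
FirstPassage-prefix-unique f []       []        _        _        eq   = refl , eq
FirstPassage-prefix-unique f []       (_ ∷ _)   done     ()       _
FirstPassage-prefix-unique f (x ∷ xs) (_ ∷ xs′) (step p) (step q) eq with refl , eq′ ← ∷-injective eq
  with refl , refl ← FirstPassage-prefix-unique f xs xs′ p q eq′ = refl , refl

-- An excursion can be inserted after a: it uses up the additional unit of height gained at a.
graft : ∀ xs {a ys zs} → d a ≡ suc (c a) →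
  (∀ {x} → x ∈ xs → c x ≡ d x) → (∀ {x} → x ∈ ys ++ zs → c x ≡ d x) →
  FirstPassage c h (xs ++ a ∷ zs) → FirstPassage c 1 ys → FirstPassage d h (xs ++ a ∷ ys ++ zs)
graft {d} {c} [] {a} da _ eq (step {h} p) q =
  step (FirstPassage-height (trans (sym (+-suc h (c a))) (cong (h +_) (sym da)))
    (FirstPassage-resp eq (FirstPassage-++ q p)))
graft {d} (x ∷ xs) da eq eq′ (step {h} p) q =
  step (FirstPassage-height (cong (h +_) (eq (here refl))) (graft xs da (eq ∘ there) eq′ p q))

-- Converse of `graft`: `us` is the stretch after `a` on which the walk gives back the additional
-- unit gained there, and `vs` continues from the height that `c` gives.
prune : ∀ (f : A → ℕ) xs {a} ys → d a ≡ suc (c a) →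
  (∀ {x} → x ∈ xs → d x ≡ c x) → (∀ {x} → x ∈ map f ys → d x ≡ c x) →
  FirstPassage d h (xs ++ a ∷ map f ys) →
  ∃₂ λ us vs → ys ≡ us ++ vs × FirstPassage c 1 (map f us) × FirstPassage c h (xs ++ a ∷ map f vs)
prune {d = d} {c} f [] {a} ys da _ eq (step {h} p)
  with us , vs , refl , q , r ← FirstPassage-split f 1 ys
         (FirstPassage-resp eq (FirstPassage-height (trans (cong (h +_) da) (+-suc h (c a))) p))
  = us , vs , refl , q , step r
prune {c = c} f (x ∷ xs) ys da eq eq′ (step {h} p)
  with us , vs , refl , q , r ← prune f xs ys da (eq ∘ there) eq′ p
  = us , vs , refl , q , step (FirstPassage-height (cong (h +_) (eq (here refl))) r)

-- Parking functions as first passage walks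

module _ {m : ℕ} (g : Fin (suc m) → ℕ) (k : ℕ) (g≡ : ∀ i → g i ≡ k + toℕ i) where

  tail-≢ : ∀ {x} → x ∈ tabulate (g ∘ suc) → x ≢ k
  tail-≢ x∈ refl with i , eq ← ∈-tabulate⁻ x∈ = m+1+n≢m k (sym (trans eq (g≡ (suc i))))

  head-≡ : g zero ≡ k
  head-≡ = trans (g≡ zero) (+-identityʳ k)

  tail-≡ : ∀ i → g (suc i) ≡ suc k + toℕ i
  tail-≡ i = trans (g≡ (suc i)) (+-suc k (toℕ i))

  head-none : ∀ {bs} → All (suc k ≤_) bs → occ bs (g zero) ≡ 0
  head-none {bs} k< = occ-none bs (All.map (λ k<x → subst (_≢ _) (sym head-≡) (<⇒≢ k<x)) k<)

  -- The label `k` has multiplicity 0 here, so reading it only lowers the walk by one.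
  advance : ∀ {bs} → All (suc k ≤_) bs →
    FirstPassage (occ bs) (suc h) (tabulate g) ⇔ FirstPassage (occ bs) h (tabulate (g ∘ suc))
  advance {h} {bs} k< = mk⇔
    (λ { (step p) → FirstPassage-height eq p })
    (λ p → step (FirstPassage-height (sym eq) p))
    where eq = trans (cong (h +_) (head-none k<)) (+-identityʳ h)

  -- A single entry `k` acts only at the first label, where it has the same effect as starting one
  -- unit higher.
  consume : ∀ bs →
    FirstPassage (occ (k ∷ bs)) (suc h) (tabulate g) ⇔ FirstPassage (occ bs) (suc (suc h)) (tabulate g)
  consume {h} bs = mk⇔
    (λ { (step p) → step (FirstPassage-height eq (FirstPassage-resp (occ-≢ bs ∘ tail-≢) p)) })
    (λ { (step p) → step (FirstPassage-height (sym eq) (FirstPassage-resp (sym ∘ occ-≢ bs ∘ tail-≢) p)) })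
    where eq = trans (cong (h +_) (occ-≡ bs head-≡)) (+-suc h _)

-- The state consists of the next label `k`, the height `h` and the sorted entries `bs` not yet
-- counted. Passing a label preserves `k + h`; counting an entry raises `h` by one and shifts the
-- index `i` by one, so the bound persists. The equation `h + length bs ≡ m` makes the walk end at
-- 0.
parking⇒passage : ∀ {m} (g : Fin m → ℕ) k h bs → (∀ i → g i ≡ k + toℕ i) →
  AllPairs _≤_ bs → All (k ≤_) bs → h + length bs ≡ m → (∀ i → lookup bs i < k + h + toℕ i) →
  FirstPassage (occ bs) h (tabulate g)
parking⇒passage {zero}  g k zero    []       _  _ _ _ _ = done
-- At height 0 with labels left, the bound puts the next entry below `k`.
parking⇒passage {suc m} g k zero    (x ∷ bs) _  _ (k≤x ∷ _) _ x< =
  contradiction (subst (x <_) (trans (+-identityʳ _) (+-identityʳ k)) (x< zero)) (≤⇒≯ k≤x)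
parking⇒passage {suc m} g k (suc h₀) bs₀ g≡ = go h₀ bs₀
  where
  skipped : ∀ h bs → AllPairs _≤_ bs → All (suc k ≤_) bs → suc h + length bs ≡ suc m →
    (∀ i → lookup bs i < k + suc h + toℕ i) → FirstPassage (occ bs) (suc h) (tabulate g)
  skipped h bs bs↗ k< len bs< = Equivalence.from (advance g k g≡ k<)
    (parking⇒passage (g ∘ suc) (suc k) h bs (tail-≡ g k g≡) bs↗ k< (suc-injective len)
      (λ i → subst (λ l → lookup bs i < l + toℕ i) (+-suc k h) (bs< i)))
  go : ∀ h bs → AllPairs _≤_ bs → All (k ≤_) bs → suc h + length bs ≡ suc m →
    (∀ i → lookup bs i < k + suc h + toℕ i) → FirstPassage (occ bs) (suc h) (tabulate g)
  go h [] bs↗ _ = skipped h [] bs↗ []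
  go h (x ∷ bs) (x≤ ∷ bs↗) (k≤x ∷ k≤) len bs< with m≤n⇒m<n∨m≡n k≤x
  ... | inj₁ k<x  = skipped h (x ∷ bs) (x≤ ∷ bs↗) (k<x ∷ All.map (≤-trans k<x) x≤) len bs<
  ... | inj₂ refl = Equivalence.from (consume g k g≡ bs)
    (go (suc h) bs bs↗ k≤ (trans (sym (+-suc (suc h) _)) len)
      (λ i → subst (lookup bs i <_) (trans (+-suc _ _) (cong (_+ toℕ i) (sym (+-suc k (suc h))))) (bs< (suc i))))

-- The same recursion, now recovering the bound from the walk. The hypothesis `_< k + m` keeps all
-- entries among the labels read, so none is left uncounted when the labels run out.
passage⇒parking : ∀ {m} (g : Fin m → ℕ) k h bs → (∀ i → g i ≡ k + toℕ i) →
  AllPairs _≤_ bs → All (k ≤_) bs → All (_< k + m) bs → FirstPassage (occ bs) h (tabulate g) →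
  h + length bs ≡ m × (∀ i → lookup bs i < k + h + toℕ i)
passage⇒parking {zero}  g k .0 []       _ _ _ _ done = refl , λ ()
passage⇒parking {zero}  g k .0 (x ∷ bs) _ _ (k≤x ∷ _) (x< ∷ _) done =
  contradiction (subst (x <_) (+-identityʳ k) x<) (≤⇒≯ k≤x)
passage⇒parking {suc m} g k (suc h₀) bs₀ g≡ = go h₀ bs₀
  where
  skipped : ∀ h bs → AllPairs _≤_ bs → All (suc k ≤_) bs → All (_< k + suc m) bs →
    FirstPassage (occ bs) (suc h) (tabulate g) →
    suc h + length bs ≡ suc m × (∀ i → lookup bs i < k + suc h + toℕ i)
  skipped h bs bs↗ k< bs< p
    with len , bs<′ ← passage⇒parking (g ∘ suc) (suc k) h bs (tail-≡ g k g≡) bs↗ k<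
           (All.map (λ {x} → subst (x <_) (+-suc k m)) bs<) (Equivalence.to (advance g k g≡ k<) p)
    = cong suc len , λ i → subst (λ l → lookup bs i < l + toℕ i) (sym (+-suc k h)) (bs<′ i)
  go : ∀ h bs → AllPairs _≤_ bs → All (k ≤_) bs → All (_< k + suc m) bs →
    FirstPassage (occ bs) (suc h) (tabulate g) →
    suc h + length bs ≡ suc m × (∀ i → lookup bs i < k + suc h + toℕ i)
  go h [] bs↗ _ = skipped h [] bs↗ []
  go h (x ∷ bs) (x≤ ∷ bs↗) (k≤x ∷ k≤) (x< ∷ bs<) p with m≤n⇒m<n∨m≡n k≤x
  ... | inj₁ k<x  = skipped h (x ∷ bs) (x≤ ∷ bs↗) (k<x ∷ All.map (≤-trans k<x) x≤) (x< ∷ bs<) p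
  ... | inj₂ refl
    with len , bs<′ ← go (suc h) bs bs↗ k≤ bs< (Equivalence.to (consume g k g≡ bs) p)
    = trans (+-suc (suc h) _) len , λ
      -- The walk reads `k` at the positive height `suc h`, which gives the bound for the entry `k`
      -- itself.
      { zero    → subst (k <_) (sym (+-identityʳ _)) (m<m+n k (s≤s z≤n))
      ; (suc i) → subst (lookup bs i <_) (sym (trans (+-suc _ _) (cong (_+ toℕ i) (sym (+-suc k (suc h)))))) (bs<′ i)
      }

-- Regions

labels : ∀ {n} → Region n → List ℕ
labels = map shortLabel

Sorted : ∀ {n} → Region n → Set
Sorted L = AllPairs _<_ (labels L)

sorted-middle : ∀ {n} (xs xs′ : Region n) {α α′ ys ys′} → Sorted (xs ++ α ∷ ys) →
  xs ++ α ∷ ys ≡ xs′ ++ α′ ∷ ys′ → shortLabel α ≡ shortLabel α′ → xs ≡ xs′ × α ≡ α′ × ys ≡ ys′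
sorted-middle xs xs′ L↗ eq α≡α′ =
  middle-unique xs xs′ (AllPairs.map⁻ L↗) eq (<-irrefl α≡α′) (<-irrefl (sym α≡α′))

sorted-++ : ∀ {n} (xs : Region n) {ys α β} → Sorted (xs ++ ys) → α ∈ xs → β ∈ ys → shortLabel α < shortLabel β
sorted-++ xs L↗ = AllPairs-++⁻ xs (AllPairs.map⁻ L↗)

sorted-⊆ : ∀ {n} {xs ys : Region n} → xs ⊆ ys → Sorted ys → Sorted xs
sorted-⊆ τ L↗ = AllPairs.map⁺ (AllPairs-resp-⊇ τ (AllPairs.map⁻ L↗))

-- Up to short labels, a move cuts a region P ++ S ++ Q with P and S nonempty
-- into S and P ++ Q, and its value is the last label of P.
data Cut {n} : Region n → Arm n → Region n → Arm n → Region n →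
         List⁺ (Arm n) → Region n → Region n → Set where
  outer : ∀ {α bt β af} → Cut [] α bt β af (α ∷⁺ bt) (β ∷ af) []
  inner : ∀ {γ bf α bt β af} → Cut (γ ∷ bf) α bt β af (γ ∷⁺ bf) (α ∷ bt) (β ∷ af)

module _ {n : ℕ} where

  cut : ∀ (bf : Region n) α bt β af → ∃ λ P → ∃₂ λ S Q → Cut bf α bt β af P S Q
  cut []       α bt β af = _ , _ , _ , outer
  cut (_ ∷ bf) α bt β af = _ , _ , _ , inner

  -- Whether `Q` is empty decides the form: the arms to join are the heads of `P` and `σ ∷ S` if it
  -- is, and of `σ ∷ S` and `Q` otherwise.
  cut⁻¹ : ∀ (P : List⁺ (Arm n)) σ S Q →
    ∃ λ bf → ∃ λ α → ∃ λ bt → ∃₂ λ β af → Cut bf α bt β af P (σ ∷ S) Q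
  cut⁻¹ (_ ∷⁺ _) σ S []      = _ , _ , _ , _ , _ , outer
  cut⁻¹ (_ ∷⁺ _) σ S (_ ∷ Q) = _ , _ , _ , _ , _ , inner

  module _ {bf : Region n} {α : Arm n} {bt : Region n} {β : Arm n} {af : Region n} where

    cut-arms : ∀ {bf′ α′ bt′ β′ af′ P S Q} → Cut bf α bt β af P S Q → Cut bf′ α′ bt′ β′ af′ P S Q →
      α ≡ α′ × β ≡ β′
    cut-arms outer outer = refl , refl
    cut-arms inner inner = refl , refl

    cut-region : ∀ {P S Q} → Cut bf α bt β af P S Q → bf ++ α ∷ bt ++ β ∷ af ≡ toList P ++ S ++ Q
    cut-region outer = cong (λ xs → α ∷ bt ++ xs) (sym (++-identityʳ _))
    cut-region inner = refl

    -- In the outer form `α` opens the region, so its predecessor is cyclically the last arm, while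
    -- `last P` precedes `β`; in the inner form `last P` precedes `α`. Either way sortedness makes
    -- `last P` the smaller predecessor.
    cut-value : ∀ {P S Q} → Cut bf α bt β af P S Q → Sorted (bf ++ α ∷ bt ++ β ∷ af) →
      shortLabel (ccwFrom α (bt ++ β ∷ af ++ bf)) ⊓ shortLabel (ccwFrom β (af ++ bf ++ α ∷ bt)) ≡ shortLabel (last P)
    cut-value outer L↗ rewrite ++-identityʳ af | last-++ α bt β af | last-++ β af α bt =
      m≥n⇒m⊓n≡n (<⇒≤ (sorted-++ (α ∷ bt) L↗ (last-∈ (α ∷⁺ bt)) (last-∈ (β ∷⁺ af))))
    cut-value (inner {γ} {bf}) L↗
      rewrite sym (++-assoc bt (β ∷ af) (γ ∷ bf)) | last-++ α (bt ++ β ∷ af) γ bf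
            | sym (++-assoc af (γ ∷ bf) (α ∷ bt)) | last-++ β (af ++ γ ∷ bf) α bt =
      m≤n⇒m⊓n≡m (<⇒≤ (sorted-++ (γ ∷ bf) L↗ (last-∈ (γ ∷⁺ bf)) (∈-++⁺ˡ (last-∈ (α ∷⁺ bt)))))

    -- The new arms inherit the labels of the arms they replace, so the two new regions have the
    -- labels of `S` and `P ++ Q`, in the opposite order for the outer form.
    cut-passage : ∀ {P S Q} → Cut bf α bt β af P S Q →
      (FirstPassage c h (labels (⟨ α , β ⟩ ∷ bt)) × FirstPassage c h (labels (bf ++ ⟨ β , α ⟩ ∷ af))) ⇔
      (FirstPassage c h (labels S) × FirstPassage c h (labels (toList P ++ Q)))
    cut-passage {c} {h} outer = mk⇔
      (λ (p , q) → q , subst (FirstPassage c h ∘ labels) (sym (++-identityʳ (α ∷ bt))) p)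
      (λ (q , p) → subst (FirstPassage c h ∘ labels) (++-identityʳ (α ∷ bt)) p , q)
    cut-passage {c} {h} inner = mk⇔
      (λ (p , q) → p , subst (FirstPassage c h) (map-middle shortLabel bf refl) q)
      (λ (p , q) → p , subst (FirstPassage c h) (map-middle shortLabel bf refl) q)

-- Positions

module _ {n : ℕ} where

  labels-last : ∀ (P : List⁺ (Arm n)) → ∃ λ xs → ∀ X → labels (toList P ++ X) ≡ xs ++ shortLabel (last P) ∷ labels X
  labels-last P with P₀ , eq ← init-last P = labels P₀ , λ X →
    trans (cong (λ Y → labels (Y ++ X)) eq) (trans (cong labels (∷ʳ-++ P₀ _ X)) (map-++ shortLabel P₀ _))

  -- By sortedness the last label of `P` occurs once in the region, so adding it to `as` changes a
  -- single step of the walk, and `graft` inserts `S` right after it.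
  merge-passage : ∀ (P : List⁺ (Arm n)) S Q as → Sorted (toList P ++ S ++ Q) →
    FirstPassage (occ as) h (labels (toList P ++ Q)) → FirstPassage (occ as) 1 (labels S) →
    FirstPassage (occ (shortLabel (last P) ∷ as)) h (labels (toList P ++ S ++ Q))
  merge-passage {h} P S Q as L↗ p q
    with xs , eq ← labels-last P
    with <last , last< ← AllPairs-middle xs (subst (AllPairs _<_) (eq (S ++ Q)) L↗)
    = subst (FirstPassage _ h) (sym (trans (eq (S ++ Q)) (cong (λ ys → xs ++ _ ∷ ys) (map-++ shortLabel S Q))))
        (graft xs (occ-≡ as refl)
          (λ x∈ → sym (occ-≢ as (<⇒≢ (All.lookup <last x∈))))
          (λ x∈ → sym (occ-≢ as (>⇒≢ (All.lookup last< (subst (_ ∈_) (sym (map-++ shortLabel S Q)) x∈)))))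
          (subst (FirstPassage _ h) (eq Q) p) q)

  -- Removing the entry for `α` from the sequence changes the walk only at `α`, so `prune` finds the
  -- stretch `S` to cut out.
  split-passage : ∀ (xs : Region n) {α} ys as → Sorted (xs ++ α ∷ ys) →
    FirstPassage (occ (shortLabel α ∷ as)) h (labels (xs ++ α ∷ ys)) →
    ∃₂ λ S Q → ys ≡ S ++ Q × FirstPassage (occ as) 1 (labels S) × FirstPassage (occ as) h (labels (xs ++ α ∷ Q))
  split-passage {h} xs {α} ys as L↗ p
    with <α , α< ← AllPairs-middle (labels xs) (subst (AllPairs _<_) (map-++ shortLabel xs _) L↗)
    with S , Q , eq , q , r ← prune shortLabel (labels xs) ys (occ-≡ as refl)
           (λ x∈ → occ-≢ as (<⇒≢ (All.lookup <α x∈))) (λ x∈ → occ-≢ as (>⇒≢ (All.lookup α< x∈)))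
           (subst (FirstPassage _ h) (map-++ shortLabel xs _) p)
    = S , Q , eq , q , subst (FirstPassage _ h) (sym (map-++ shortLabel xs _)) r

  -- Splitting a region by a move

  module _ (bf : Region n) (α : Arm n) (bt : Region n) (β : Arm n) (af : Region n) where

    -- A move only redistributes labels between the two sides of the arc, because each new arm
    -- inherits the label of a joined arm.
    split-↭ : labels (bf ++ α ∷ bt ++ β ∷ af) ↭ labels (⟨ α , β ⟩ ∷ bt) ++ labels (bf ++ ⟨ β , α ⟩ ∷ af)
    split-↭ = ↭-trans (map⁺ shortLabel (shifts bf (α ∷ bt)))
      (↭-reflexive (trans (map-++ shortLabel (α ∷ bt) _) (cong (labels (α ∷ bt) ++_) (map-middle shortLabel bf refl))))

    split-∈ : ∀ {x} → x ∈ labels (bf ++ α ∷ bt ++ β ∷ af) ⇔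
      (x ∈ labels (⟨ α , β ⟩ ∷ bt) ⊎ x ∈ labels (bf ++ ⟨ β , α ⟩ ∷ af))
    split-∈ = mk⇔ (∈-++⁻ _ ∘ ∈-resp-↭ split-↭)
      λ { (inj₁ x∈) → ∈-resp-↭ (↭-sym split-↭) (∈-++⁺ˡ x∈)
        ; (inj₂ x∈) → ∈-resp-↭ (↭-sym split-↭) (∈-++⁺ʳ (labels (α ∷ bt)) x∈) }

    module _ (L↗ : Sorted (bf ++ α ∷ bt ++ β ∷ af)) where

      split-sorted : Sorted (⟨ α , β ⟩ ∷ bt) × Sorted (bf ++ ⟨ β , α ⟩ ∷ af)
      split-sorted =
        sorted-⊆ {ys = bf ++ α ∷ bt ++ β ∷ af} (Sublist.++⁺ˡ bf (Sublist.++⁺ʳ (β ∷ af) (⊆-refl {x = α ∷ bt}))) L↗ ,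
        subst (AllPairs _<_) (map-middle shortLabel bf refl)
          (sorted-⊆ {ys = bf ++ α ∷ bt ++ β ∷ af} (Sublist.++⁺ (⊆-refl {x = bf}) (Sublist.++⁺ˡ (α ∷ bt) ⊆-refl)) L↗)

      -- A sorted region has distinct labels, and distinctness survives the permutation `split-↭`.
      split-disjoint : Disjoint (labels (⟨ α , β ⟩ ∷ bt)) (labels (bf ++ ⟨ β , α ⟩ ∷ af))
      split-disjoint (x∈ , x∈′) = AllPairs-++⁻ _
        (Unique-resp-↭ (↭⇒↭ₛ split-↭) (AllPairs.map <⇒≢ L↗)) x∈ x∈′ refl

  -- Invariants of positions

  record WellFormed (s : Position n) : Set where
    field
      nonempty : All (_≢ []) s
      sorted   : All Sorted s
      disjoint : AllPairs (Disjoint on labels) s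

  -- Characterises the sequences of the plays from s.
  record Playable (s : Position n) (as : List ℕ) : Set where
    field
      passages : All (FirstPassage (occ as) 1 ∘ labels) s
      known    : All (λ a → Any ((a ∈_) ∘ labels) s) as

  open WellFormed
  open Playable

  middle-sorted : ∀ Rˡ {L Rʳ} → WellFormed (Rˡ ++ L ∷ Rʳ) → Sorted L
  middle-sorted Rˡ wf = All.head (All.++⁻ʳ Rˡ (sorted wf))

  result-wellFormed : ∀ {s} → WellFormed s → (m : Move s) → WellFormed (Move.result m)
  result-wellFormed wf record { regionsˡ = Rˡ ; α = α ; β = β ; before = bf ; between = bt ; after = af ; s≡ = refl } = record
    { nonempty = All-replace Rˡ (λ _ → (λ ()) , ++-∷-≢[] bf) (nonempty wf)
    ; sorted   = All-replace Rˡ (split-sorted bf α bt β af) (sorted wf)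
    ; disjoint = AllPairs-replace Rˡ
        (λ d → (λ (p , q) → d (p , from (inj₁ q))) , λ (p , q) → d (p , from (inj₂ q)))
        (λ d → (λ (p , q) → d (from (inj₁ p) , q)) , λ (p , q) → d (from (inj₂ p) , q))
        (split-disjoint bf α bt β af (middle-sorted Rˡ wf)) (disjoint wf)
    }
    where
    from : ∀ {x} → x ∈ labels (⟨ α , β ⟩ ∷ bt) ⊎ x ∈ labels (bf ++ ⟨ β , α ⟩ ∷ af) →
      x ∈ labels (bf ++ α ∷ bt ++ β ∷ af)
    from = Equivalence.from (split-∈ bf α bt β af)

  -- Moves determined by the joined arms

  region : ∀ {s} → Move s → Region n
  region m = Move.before m ++ Move.α m ∷ Move.between m ++ Move.β m ∷ Move.after m

  region-sorted : ∀ {s} → WellFormed s → (m : Move s) → Sorted (region m)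
  region-sorted wf record { regionsˡ = Rˡ ; s≡ = refl } = middle-sorted Rˡ wf

  common-region : ∀ {x} Rˡ Rˡ′ {L L′ Rʳ Rʳ′} → WellFormed (Rˡ ++ L ∷ Rʳ) → Rˡ ++ L ∷ Rʳ ≡ Rˡ′ ++ L′ ∷ Rʳ′ →
    x ∈ labels L → x ∈ labels L′ → Rˡ ≡ Rˡ′ × L ≡ L′ × Rʳ ≡ Rʳ′
  common-region Rˡ Rˡ′ wf eq x∈ x∈′ =
    middle-unique Rˡ Rˡ′ (disjoint wf) eq (λ d → d (x∈ , x∈′)) (λ d → d (x∈′ , x∈))

  α∈ : ∀ (bf : Region n) {α xs} → shortLabel α ∈ labels (bf ++ α ∷ xs)
  α∈ bf = ∈-map⁺ shortLabel (∈-++⁺ʳ bf (here refl))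

  -- The label of `α` fixes the region, and sortedness then fixes the places of `α` and `β` in it.
  move-unique : ∀ {s} → WellFormed s → (m m′ : Move s) →
    Move.α m ≡ Move.α m′ → Move.β m ≡ Move.β m′ → m ≡ m′
  move-unique wf
    record { regionsˡ = Rˡ ; α = α ; before = bf ; between = bt ; s≡ = refl }
    record { regionsˡ = Rˡ′ ; before = bf′ ; between = bt′ ; s≡ = eq } refl refl
    with refl , L≡ , refl ← common-region Rˡ Rˡ′ wf eq (α∈ bf) (α∈ bf′)
    with refl , _ , bt≡ ← sorted-middle bf bf′ (middle-sorted Rˡ wf) L≡ refl
    with refl , _ , refl ← sorted-middle (α ∷ bt) (α ∷ bt′)
           (sorted-⊆ (Sublist.++⁺ˡ bf ⊆-refl) (middle-sorted Rˡ wf)) (cong (α ∷_) bt≡) refl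
    -- Only the two proofs of `s≡` may still differ; uniqueness of identity proofs equates them.
    with refl ← eq = refl

  α<β : ∀ {s} → WellFormed s → (m : Move s) → shortLabel (Move.α m) < shortLabel (Move.β m)
  α<β wf m = sorted-++ [ Move.α m ] (sorted-⊆ (Sublist.++⁺ˡ (Move.before m) ⊆-refl) (region-sorted wf m))
    (here refl) (∈-++⁺ʳ (Move.between m) (here refl))

  -- Every move lists the arm with the smaller label first, which rules out the swapped pair.
  samePair⇒≡ : ∀ {s} → WellFormed s → (m m′ : Move s) → SamePair (Move.joinedArms m) (Move.joinedArms m′) → m ≡ m′
  samePair⇒≡ wf m m′ (inj₁ (α≡ , β≡)) = move-unique wf m m′ α≡ β≡
  samePair⇒≡ wf m m′ (inj₂ (refl , refl)) = contradiction (α<β wf m) (<-asym (α<β wf m′))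

  -- Moves determined by the value and the remaining sequence

  value-≡ : ∀ {s P S Q} → WellFormed s → (m : Move s) →
    Cut (Move.before m) (Move.α m) (Move.between m) (Move.β m) (Move.after m) P S Q →
    Move.value m ≡ shortLabel (last P)
  value-≡ wf m ct = cut-value ct (region-sorted wf m)

  value∈ : ∀ {s} → WellFormed s → (m : Move s) → Move.value m ∈ labels (region m)
  value∈ wf m with P , S , Q , ct ← cut (Move.before m) (Move.α m) (Move.between m) (Move.β m) (Move.after m) =
    subst (_∈ labels (region m)) (sym (value-≡ wf m ct))
      (∈-map⁺ shortLabel (subst (last P ∈_) (sym (cut-region ct)) (∈-++⁺ˡ (last-∈ P))))

  result-passages : ∀ {s as} (m : Move s) → Playable (Move.result m) as →
    FirstPassage (occ as) 1 (labels (⟨ Move.α m , Move.β m ⟩ ∷ Move.between m)) ×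
    FirstPassage (occ as) 1 (labels (Move.before m ++ ⟨ Move.β m , Move.α m ⟩ ∷ Move.after m))
  result-passages m pl with p ∷ q ∷ _ ← All.++⁻ʳ (Move.regionsˡ m) (passages pl) = p , q

  -- The last label of `P` fixes where `P` ends; the list after it is then common, and the first
  -- arrival of the walk at 0 fixes where `S` ends.
  cut-unique : ∀ (P P′ : List⁺ (Arm n)) S S′ {Q Q′} → Sorted (toList P ++ S ++ Q) →
    toList P ++ S ++ Q ≡ toList P′ ++ S′ ++ Q′ → shortLabel (last P) ≡ shortLabel (last P′) →
    FirstPassage c h (labels S) → FirstPassage c h (labels S′) →
    P ≡ P′ × S ≡ S′ × Q ≡ Q′
  cut-unique P P′ S S′ L↗ eq last≡ p p′
    with P₀ , P≡ ← init-last P | P₀′ , P≡′ ← init-last P′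
    with eq₁ ← trans (cong (_++ S ++ _) P≡) (∷ʳ-++ P₀ _ _)
       | eq₂ ← trans (cong (_++ S′ ++ _) P≡′) (∷ʳ-++ P₀′ _ _)
    with P₀≡ , last≡′ , SQ≡ ← sorted-middle P₀ P₀′ (subst Sorted eq₁ L↗) (trans (sym eq₁) (trans eq eq₂)) last≡
    with S≡ , Q≡ ← FirstPassage-prefix-unique shortLabel S S′ p p′ SQ≡
    = toList-injective (trans P≡ (trans (cong₂ _∷ʳ_ P₀≡ last≡′) (sym P≡′))) , S≡ , Q≡

  -- The value alone fixes the region and the end of `P`, but not the length of `S`; this is decided
  -- by the walk for the rest `as` of the sequence.
  value-injective : ∀ {s as} → WellFormed s → (m m′ : Move s) → Move.value m ≡ Move.value m′ →
    Playable (Move.result m) as → Playable (Move.result m′) as → m ≡ m′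
  value-injective {s} {as} wf m@record { regionsˡ = Rˡ ; s≡ = refl } m′ v≡ pl pl′
    with _ , L≡ , _ ← common-region Rˡ (Move.regionsˡ m′) wf (Move.s≡ m′)
           (value∈ wf m) (subst (_∈ labels (region m′)) (sym v≡) (value∈ wf m′))
    with P  , S  , Q  , ct  ← cut (Move.before m) (Move.α m) (Move.between m) (Move.β m) (Move.after m)
       | P′ , S′ , Q′ , ct′ ← cut (Move.before m′) (Move.α m′) (Move.between m′) (Move.β m′) (Move.after m′)
    with refl , refl , refl ← cut-unique {c = occ as} P P′ S S′ (subst Sorted (cut-region ct) (region-sorted wf m))
           (trans (sym (cut-region ct)) (trans L≡ (cut-region ct′)))
           (trans (sym (value-≡ wf m ct)) (trans v≡ (value-≡ wf m′ ct′)))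
           (proj₁ (Equivalence.to (cut-passage ct) (result-passages m pl)))
           (proj₁ (Equivalence.to (cut-passage ct′) (result-passages m′ pl′)))
    with α≡ , β≡ ← cut-arms ct ct′ = move-unique wf m m′ α≡ β≡

  -- Playable sequences before and after a move

  passage-∉ : ∀ {v as xs} → v ∉ xs → FirstPassage (occ as) h xs ⇔ FirstPassage (occ (v ∷ as)) h xs
  passage-∉ {v = v} {as} {xs} v∉ = mk⇔ (FirstPassage-resp {c = occ as} (sym ∘ occ≡)) (FirstPassage-resp occ≡)
    where
    occ≡ : ∀ {x} → x ∈ xs → occ (v ∷ as) x ≡ occ as x
    occ≡ x∈ = occ-≢ as λ { refl → v∉ x∈ }

  other-regions : ∀ {v} Rˡ {L : Region n} {Rʳ} → WellFormed (Rˡ ++ L ∷ Rʳ) → v ∈ labels L →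
    All ((v ∉_) ∘ labels) Rˡ × All ((v ∉_) ∘ labels) Rʳ
  other-regions Rˡ wf v∈ with dˡ , dʳ ← AllPairs-middle Rˡ (disjoint wf) =
    All.map (λ d v∈′ → d (v∈′ , v∈)) dˡ , All.map (λ d v∈′ → d (v∈ , v∈′)) dʳ

  passages-∉ : ∀ {v as} {Rs : Position n} → All ((v ∉_) ∘ labels) Rs →
    All (FirstPassage (occ as) 1 ∘ labels) Rs ⇔ All (FirstPassage (occ (v ∷ as)) 1 ∘ labels) Rs
  passages-∉ {as = as} v∉ = mk⇔
    (λ ps → All.zipWith (λ (v∉L , p) → Equivalence.to (passage-∉ {as = as} v∉L) p) (v∉ , ps))
    (λ ps → All.zipWith (λ (v∉L , p) → Equivalence.from (passage-∉ {as = as} v∉L) p) (v∉ , ps))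

  known-result : ∀ {s : Position n} {a} (m : Move s) →
    Any ((a ∈_) ∘ labels) s ⇔ Any ((a ∈_) ∘ labels) (Move.result m)
  known-result record { regionsˡ = Rˡ ; α = α ; β = β ; before = bf ; between = bt ; after = af ; s≡ = refl } =
    Any-replace Rˡ (split-∈ bf α bt β af)

  value-known : ∀ {s} → WellFormed s → (m : Move s) → Any ((Move.value m ∈_) ∘ labels) s
  value-known wf m@record { regionsˡ = Rˡ ; s≡ = refl } = Any.++⁺ʳ Rˡ (here (value∈ wf m))

  -- The value is a label of the moved region only, so the other walks keep their steps; in that
  -- region `merge-passage` reassembles the two parts.
  playable-value∷ : ∀ {s as} → WellFormed s → (m : Move s) →
    Playable (Move.result m) as → Playable s (Move.value m ∷ as)
  playable-value∷ {as = as} wf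
    m@record { regionsˡ = Rˡ ; α = α ; β = β ; before = bf ; between = bt ; after = af ; s≡ = refl } pl
    with ps , p ∷ q ∷ qs ← All.++⁻ Rˡ (passages pl)
    with P , S , Q , ct ← cut bf α bt β af
    with ∉ˡ , ∉ʳ ← other-regions Rˡ wf (value∈ wf m)
    with pS , pPQ ← Equivalence.to (cut-passage ct) (p , q)
    = record
    { passages = All.++⁺ (Equivalence.to (passages-∉ ∉ˡ) ps) (passage ∷ Equivalence.to (passages-∉ ∉ʳ) qs)
    ; known    = value-known wf m ∷ All.map (Equivalence.from (known-result m)) (known pl)
    }
    where
    passage : FirstPassage (occ (Move.value m ∷ as)) 1 (labels (region m))
    passage = subst₂ (λ v L → FirstPassage (occ (v ∷ as)) 1 (labels L)) (sym (value-≡ wf m ct)) (sym (cut-region ct))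
      (merge-passage P S Q as (subst Sorted (cut-region ct) (region-sorted wf m)) pPQ pS)

  playable-result : ∀ {s as} → WellFormed s → (m : Move s) → Playable s (Move.value m ∷ as) →
    FirstPassage (occ as) 1 (labels (⟨ Move.α m , Move.β m ⟩ ∷ Move.between m)) →
    FirstPassage (occ as) 1 (labels (Move.before m ++ ⟨ Move.β m , Move.α m ⟩ ∷ Move.after m)) →
    Playable (Move.result m) as
  playable-result wf m@record { regionsˡ = Rˡ ; s≡ = refl } pl p q
    with ps , _ ∷ qs ← All.++⁻ Rˡ (passages pl)
    with ∉ˡ , ∉ʳ ← other-regions Rˡ wf (value∈ wf m)
    = record
    { passages = All.++⁺ (Equivalence.from (passages-∉ ∉ˡ) ps) (p ∷ q ∷ Equivalence.from (passages-∉ ∉ʳ) qs)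
    ; known    = All.map (Equivalence.to (known-result m)) (All.tail (known pl))
    }

  -- The entry `a` names the arm where `P` has to end; `split-passage` finds `S`, and `cut⁻¹` turns
  -- the cut into a move.
  playable-move : ∀ {s a as} → WellFormed s → Playable s (a ∷ as) →
    ∃ λ (m : Move s) → Move.value m ≡ a × Playable (Move.result m) as
  playable-move {as = as} wf pl
    with L , L∈ , a∈ ← find (All.head (known pl))
    with α , α∈L , refl ← ∈-map⁻ shortLabel a∈
    with Rˡ , Rʳ , refl ← ∈-∃++ L∈
    with xs , ys , refl ← ∈-∃++ α∈L
    with p ∷ _ ← All.++⁻ʳ Rˡ (passages pl)
    -- `S` is nonempty because a walk at height 1 cannot end on the empty list.
    with σ ∷ S , Q , refl , pS , pPQ ← split-passage xs ys as (middle-sorted Rˡ wf) p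
    with P , P≡ , refl ← snoc⁺ xs α
    with bf , α′ , bt , β′ , af , ct ← cut⁻¹ P σ S Q
    = m , value≡ , playable-result wf m (subst (λ v → Playable _ (v ∷ as)) (sym value≡) pl) (proj₁ pqs) (proj₂ pqs)
    where
    P++ : ∀ X → toList P ++ X ≡ xs ++ last P ∷ X
    P++ X = trans (cong (_++ X) P≡) (∷ʳ-++ xs _ X)
    m : Move _
    m = record { regionsˡ = Rˡ ; regionsʳ = Rʳ ; α = α′ ; β = β′ ; before = bf ; between = bt ; after = af
               ; s≡ = cong (λ L → Rˡ ++ L ∷ Rʳ) (trans (sym (P++ _)) (sym (cut-region ct))) }
    value≡ : Move.value m ≡ shortLabel (last P)
    value≡ = value-≡ wf m ct
    pqs = Equivalence.from (cut-passage ct) (pS , subst (FirstPassage _ 1 ∘ labels) (sym (P++ Q)) pPQ)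

  -- With no entries left every step goes down by one, so height 1 is used up by a single label.
  passage-[] : ∀ {x xs} → FirstPassage (occ []) 1 (x ∷ xs) → xs ≡ []
  passage-[] (step done) = refl

  playable-[]⇒over : ∀ {s} → Playable s [] → ¬ Move s
  playable-[]⇒over pl record { regionsˡ = Rˡ ; before = bf ; between = bt ; s≡ = refl } =
    absurd bf (All.head (All.++⁻ʳ Rˡ (passages pl)))
    where
    absurd : ∀ bf → ¬ FirstPassage (occ []) 1 (labels (bf ++ _ ∷ bt ++ _ ∷ _))
    absurd []       p = ++-∷-≢[] (labels bt) (trans (sym (map-++ shortLabel bt _)) (passage-[] p))
    absurd (_ ∷ bf) p = ++-∷-≢[] (labels bf) (trans (sym (map-++ shortLabel bf _)) (passage-[] p))

  -- Two arms in one region could be joined, and regions are nonempty, so at the end each has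
  -- exactly one arm.
  over⇒playable-[] : ∀ {s} → WellFormed s → ¬ Move s → Playable s []
  over⇒playable-[] {s} wf ¬m = record { passages = All.tabulate passage ; known = [] }
    where
    passage : ∀ {L} → L ∈ s → FirstPassage (occ []) 1 (labels L)
    passage {[]}        L∈ = contradiction refl (All.lookup (nonempty wf) L∈)
    passage {_ ∷ []}    L∈ = step done
    passage {_ ∷ _ ∷ _} L∈ with _ , _ , refl ← ∈-∃++ L∈ =
      contradiction (record { before = [] ; between = [] ; s≡ = refl }) ¬m

  -- Plays and their sequences

  sequence-playable : ∀ {s} → WellFormed s → (p : Play s) → Playable s (sequence p)
  sequence-playable wf (end ¬m) = over⇒playable-[] wf ¬m
  sequence-playable wf (m ▸ p)  = playable-value∷ wf m (sequence-playable (result-wellFormed wf m) p)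

  playable-sequence : ∀ {s} as → WellFormed s → Playable s as → ∃ λ (p : Play s) → sequence p ≡ as
  playable-sequence []       wf pl = end (playable-[]⇒over pl) , refl
  playable-sequence (a ∷ as) wf pl
    with m , value≡ , pl′ ← playable-move wf pl
    with p , refl ← playable-sequence as (result-wellFormed wf m) pl′ = m ▸ p , cong (_∷ as) value≡

  sequence-cong : ∀ {s} → WellFormed s → (p q : Play s) → p ≈ q → sequence p ≡ sequence q
  sequence-cong wf (end _) (end _) _ = refl
  sequence-cong wf (m ▸ p) (m′ ▸ q) (same ∷ p≈q) with refl ← samePair⇒≡ wf m m′ same =
    cong (_ ∷_) (sequence-cong (result-wellFormed wf m) p q p≈q)

  sequence-injective : ∀ {s} → WellFormed s → (p q : Play s) → sequence p ≡ sequence q → p ≈ q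
  sequence-injective wf (end _) (end _) _ = []
  sequence-injective wf (m ▸ p) (m′ ▸ q) eq
    with value≡ , eq′ ← ∷-injective eq
    with refl ← value-injective wf m m′ value≡
           -- The remaining sequences agree, so both results are playable with the same rest, as
           -- comparing the two moves requires.
           (subst (Playable _) eq′ (sequence-playable (result-wellFormed wf m) p))
           (sequence-playable (result-wellFormed wf m′) q)
    = inj₁ (refl , refl) ∷ sequence-injective (result-wellFormed wf m) p q eq′

-- The starting position

labels-start : ∀ n → labels (map original (allFin n)) ≡ tabulate (suc ∘ toℕ)
labels-start n = trans (cong labels (map-tabulate {n = n} (λ i → i) original)) (map-tabulate original shortLabel)

start-wellFormed : ∀ m → WellFormed (start (suc m))
start-wellFormed m = record
  { nonempty = (λ ()) ∷ []
  ; sorted   = subst (AllPairs _<_) (sym (labels-start (suc m))) (AllPairs.tabulate⁺-< s≤s) ∷ []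
  ; disjoint = [] ∷ []
  }

-- Sorting keeps multiplicities and hence the walk. With first label 1 and height 1 the bound
-- `k + h + toℕ i` becomes `2 + toℕ i`, which is the parking condition in strict form.
parking⇔playable : ∀ m as → IsParkingFunction m as ⇔ Playable (start (suc m)) as
parking⇔playable m as = mk⇔ to from
  where
  as↗ : List ℕ
  as↗ = sort ≤-decTotalOrder as
  as↗↭as : as↗ ↭ as
  as↗↭as = sort-↭ ≤-decTotalOrder as
  ascending : AllPairs _≤_ as↗
  ascending = Sorted⇒AllPairs ≤-totalOrder (sort-↗ ≤-decTotalOrder as)
  passage-sort : ∀ {xs} → FirstPassage (occ as↗) 1 xs ⇔ FirstPassage (occ as) 1 xs
  passage-sort = mk⇔
    (FirstPassage-resp (λ {x} _ → occ-↭ x as↗↭as))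
    (FirstPassage-resp (λ {x} _ → sym (occ-↭ x as↗↭as)))

  to : IsParkingFunction m as → Playable (start (suc m)) as
  to pf = record
    { passages = subst (FirstPassage (occ as) 1) (sym (labels-start (suc m))) (Equivalence.to passage-sort
        (parking⇒passage (suc ∘ toℕ) 1 1 as↗ (λ _ → refl) ascending (All.map proj₁ (All-resp-↭ (↭-sym as↗↭as) inRange))
          (cong suc (trans (↭-length as↗↭as) hasLength)) (s≤s ∘ sorted≤))) ∷ []
    ; known = All.map (λ {a} a∈ → here (subst (a ∈_) (sym (labels-start (suc m))) (label∈ a∈))) inRange
    }
    where
    open IsParkingFunction pf
    label∈ : ∀ {a} → 1 ≤ a × a ≤ m → a ∈ tabulate {n = suc m} (suc ∘ toℕ)
    label∈ {suc a} (_ , a<m) = subst (λ x → suc x ∈ tabulate {n = suc m} (suc ∘ toℕ)) (toℕ-fromℕ< _)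
      (∈-tabulate⁺ {f = suc ∘ toℕ} (fromℕ< (m≤n⇒m≤1+n a<m)))

  known-range : ∀ {a} → Any ((a ∈_) ∘ labels) (start (suc m)) → 1 ≤ a × a < suc (suc m)
  known-range {a} (here a∈)
    with i , refl ← ∈-tabulate⁻ {f = suc ∘ toℕ} (subst (a ∈_) (labels-start (suc m)) a∈) = s≤s z≤n , s≤s (toℕ<n i)

  -- The labels at the start reach up to `suc m`, one more than a parking function allows; the bound
  -- at the last index excludes that value.
  ≤m : ∀ {a bs} → (∀ i → lookup bs i < 2 + toℕ i) → length bs ≡ m → a ∈ bs → a ≤ m
  ≤m bound refl a∈ = subst (_≤ m) (sym (lookup-index a∈))
    (≤-trans (s≤s⁻¹ (bound (Any.index a∈))) (toℕ<n (Any.index a∈)))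

  from : Playable (start (suc m)) as → IsParkingFunction m as
  from pl with range ← All.map known-range (Playable.known pl)
    with len , bound ← passage⇒parking (suc ∘ toℕ) 1 1 as↗ (λ _ → refl) ascending
           (All-resp-↭ (↭-sym as↗↭as) (All.map proj₁ range)) (All-resp-↭ (↭-sym as↗↭as) (All.map proj₂ range))
           (Equivalence.from passage-sort (subst (FirstPassage (occ as) 1) (labels-start (suc m))
             (All.head (Playable.passages pl))))
    = record
    { hasLength = trans (↭-length (↭-sym as↗↭as)) (suc-injective len)
    ; inRange   = All.tabulate λ {a} a∈ →
        proj₁ (All.lookup range a∈) , ≤m bound (suc-injective len) (∈-resp-↭ (↭-sym as↗↭as) a∈)
    ; sorted≤   = s≤s⁻¹ ∘ bound
    }

theorem4 : (n : ℕ) → 2 ≤ n →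
    Congruent {A = LineOfPlay n} _≈_ _≡_ sequence
    × Injective {A = LineOfPlay n} _≈_ _≡_ sequence
    × ((as : List ℕ) →
    (∃ λ (p : LineOfPlay n) → sequence p ≡ as) ⇔ IsParkingFunction (n ∸ 1) as)
theorem4 (suc m) _ =
  (λ {p} {q} → sequence-cong wf p q) ,
  (λ {p} {q} → sequence-injective wf p q) ,
  λ as → mk⇔
    (λ { (p , refl) → Equivalence.from (parking⇔playable m as) (sequence-playable wf p) })
    (playable-sequence as wf ∘ Equivalence.to (parking⇔playable m as))
  where wf = start-wellFormed m
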